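{- For all integers $n\ge 0$, the number $p(n)$ of integer partitions of $n$ is equal to the number $gs(n)$ of receding stacks with summits of size $n$: $$gs(n)=p(n).$$
   Context: A receding stack with summit of size $n\ge 1$ is a finite sequence of positive integers summing to $n$, written as $a_1,\dots,a_r,c,b_s,b_{s-1},\dots,b_1$ with $r,s\ge 0$, in which one occurrence $c$ of the largest part is marked as the summit, such that $1\le a_1\le a_2\le\dots\le a_r\le c$ and $c\ge b_s\ge b_{s-1}\ge\dots\ge b_1\ge 1$, and such that every integer from $1$ to $c-1$ occurs at least once among $a_1,\dots,a_r$ and at least once among $b_1,\dots,b_s$. Sequences with different marked occurrences of the largest part are counted as distinct. For example, with the summit overlined, the receding stacks with summits of size $4$ are $1\overline{2}1$, $\overline{1}111$, $1\overline{1}11$, $11\overline{1}1$, $111\overline{1}$, so $gs(4)=5$. By convention $gs(0)=1$ (the empty stack), and $p(0)=1$. -}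

module Defs where

open import Data.List using (List; []; _∷_; [_]; _++_; concatMap; deduplicate; filter; length; map)
open import Data.List.Membership.DecPropositional using (_∈?_)
open import Data.List.Membership.Propositional using (_∈_; lose)
open import Data.List.Membership.Propositional.Properties
  using (∈-concatMap⁺; ∈-deduplicate⁺; ∈-deduplicate⁻; ∈-filter⁺; ∈-filter⁻; ∈-map⁺)
open import Data.List.Properties using (≡-dec)
open import Data.List.Relation.Unary.All as All using (All; []; _∷_)
open import Data.List.Relation.Unary.All.Properties using (++⁺; ++⁻ˡ)
open import Data.List.Relation.Unary.Any using (here; there)
open import Data.List.Relation.Unary.Linked as Linked using (Linked; _∷_)
open import Data.List.Relation.Unary.Unique.Propositional using (Unique)
open import Data.List.Relation.Unary.Unique.DecPropositional.Properties using (deduplicate-!)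
open import Data.Nat using (ℕ; zero; suc; _+_; _≤_; _≥_; _<_; s≤s; z≤n; _≤?_; _≥?_; _≟_)
open import Data.Nat.ListAction using (sum)
open import Data.Nat.Properties using (allUpTo?; ≤-trans)
open import Data.Product using (_×_; _,_; proj₁; proj₂)
import Data.Product.Properties as Product
open import Function.Bundles using (_⇔_; mk⇔)
open import Relation.Binary.Definitions using (DecidableEquality)
open import Relation.Binary.PropositionalEquality using (_≡_; refl; subst)
open import Relation.Nullary.Decidable using (map′; _×-dec_; _→-dec_)
open import Relation.Unary using (Pred; Decidable)
open import Level using (0ℓ)

record Enumeration {A : Set} (P : Pred A 0ℓ) : Set where
  field
    elements : List A
    unique   : Unique elements
    exact    : ∀ {x} → x ∈ elements ⇔ P x

-- Independent of the chosen enumeration: two duplicate-free lists with the same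
-- members have the same length.
card : ∀ {A : Set} {P : Pred A 0ℓ} → Enumeration P → ℕ
card E = length (Enumeration.elements E)

enumerate : ∀ {A : Set} {P : Pred A 0ℓ} → DecidableEquality A → Decidable P →
            (candidates : List A) → (∀ {x} → P x → x ∈ candidates) → Enumeration P
enumerate _≟A_ P? candidates complete = record
  { elements = deduplicate _≟A_ (filter P? candidates)
  ; unique   = deduplicate-! _≟A_ (filter P? candidates)
  ; exact    = mk⇔
      (λ x∈ → proj₂ (∈-filter⁻ P? {xs = candidates} (∈-deduplicate⁻ _≟A_ (filter P? candidates) x∈)))
      (λ px → ∈-deduplicate⁺ _≟A_ (∈-filter⁺ P? (complete px) px))
  }

record IsPartition (n : ℕ) (parts : List ℕ) : Set where
  constructor isPartition
  field
    positive   : All (1 ≤_) parts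
    decreasing : Linked _≥_ parts
    size       : sum parts ≡ n

-- (l , c , r) is the sequence l ++ c ∷ r with its entry c marked as the summit;
-- r is listed from left to right, that is, as b_s , … , b_1.
MarkedSequence : Set
MarkedSequence = List ℕ × ℕ × List ℕ

entries : MarkedSequence → List ℕ
entries (l , c , r) = l ++ c ∷ r

-- The fields `rising` and `falling` are the chains 1 ≤ a_1 ≤ … ≤ a_r ≤ c and
-- c ≥ b_s ≥ … ≥ b_1 ≥ 1, including their end terms.
record IsRecedingStack (n : ℕ) (s : MarkedSequence) : Set where
  constructor isRecedingStack
  left : List ℕ
  left = proj₁ s
  summit : ℕ
  summit = proj₁ (proj₂ s)
  right : List ℕ
  right = proj₂ (proj₂ s)
  field
    rising   : Linked _≤_ (1 ∷ left ++ [ summit ])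
    falling  : Linked _≥_ (summit ∷ right ++ [ 1 ])
    receding : ∀ i → 1 ≤ i → i < summit → i ∈ left × i ∈ right
    size     : sum (entries s) ≡ n

isPartition? : ∀ n → Decidable (IsPartition n)
isPartition? n parts =
  map′ (λ (p , d , s) → isPartition p d s) (λ (isPartition p d s) → p , d , s)
    (All.all? (1 ≤?_) parts ×-dec Linked.linked? _≥?_ parts ×-dec sum parts ≟ n)

isRecedingStack? : ∀ n → Decidable (IsRecedingStack n)
isRecedingStack? n (l , c , r) =
  map′ (λ (u , d , g , s) → isRecedingStack u d (λ i 1≤i i<c → g {i} i<c 1≤i) s)
       (λ (isRecedingStack u d g s) → u , d , (λ {i} i<c 1≤i → g i 1≤i i<c) , s)
    (Linked.linked? _≤?_ (1 ∷ l ++ [ c ])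
      ×-dec Linked.linked? _≥?_ (c ∷ r ++ [ 1 ])
      ×-dec allUpTo? (λ i → 1 ≤? i →-dec (_∈?_ _≟_ i l ×-dec _∈?_ _≟_ i r)) c
      ×-dec sum (l ++ c ∷ r) ≟ n)

extend : List ℕ → List (List ℕ)
extend []       = [ 1 ∷ [] ]
extend (x ∷ xs) = (1 ∷ x ∷ xs) ∷ (suc x ∷ xs) ∷ []

compositions : ℕ → List (List ℕ)
compositions zero    = [ [] ]
compositions (suc n) = concatMap extend (compositions n)

compositions-complete : ∀ {xs} → All (1 ≤_) xs → xs ∈ compositions (sum xs)
compositions-complete [] = here refl
compositions-complete (_∷_ {suc x} {xs} _ pos) = go x
  where
  one∈extend : ∀ ys → 1 ∷ ys ∈ extend ys
  one∈extend []      = here refl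
  one∈extend (_ ∷ _) = here refl

  go : ∀ x → suc x ∷ xs ∈ compositions (suc x + sum xs)
  go zero    = ∈-concatMap⁺ extend (lose (compositions-complete pos) (one∈extend xs))
  go (suc x) = ∈-concatMap⁺ extend (lose (go x) (there (here refl)))

markings : List ℕ → List MarkedSequence
markings []       = []
markings (x ∷ xs) = ([] , x , xs) ∷ map (λ (l , c , r) → x ∷ l , c , r) (markings xs)

markings-complete : ∀ l {c r} → (l , c , r) ∈ markings (l ++ c ∷ r)
markings-complete []      = here refl
markings-complete (x ∷ l) = there (∈-map⁺ _ (markings-complete l))

rising⇒positive : ∀ {k} xs {c} → 1 ≤ k → Linked _≤_ (k ∷ xs ++ [ c ]) → All (1 ≤_) (xs ++ [ c ])
rising⇒positive []       1≤k (k≤c ∷ _)    = ≤-trans 1≤k k≤c ∷ []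
rising⇒positive (x ∷ xs) 1≤k (k≤x ∷ rest) =
  ≤-trans 1≤k k≤x ∷ rising⇒positive xs (≤-trans 1≤k k≤x) rest

falling⇒positive : ∀ {k} xs → Linked _≥_ (k ∷ xs ++ [ 1 ]) → All (1 ≤_) (k ∷ xs)
falling⇒positive []       (k≥1 ∷ _)    = k≥1 ∷ []
falling⇒positive (x ∷ xs) (k≥x ∷ rest) with falling⇒positive xs rest
... | 1≤x ∷ pos = ≤-trans 1≤x k≥x ∷ 1≤x ∷ pos

stack⇒positive : ∀ {n s} → IsRecedingStack n s → All (1 ≤_) (entries s)
stack⇒positive {s = l , c , r} st =
  ++⁺ (++⁻ˡ l (rising⇒positive l (s≤s z≤n) rising)) (falling⇒positive r falling)
  where
  open IsRecedingStack st

partitions : ∀ n → Enumeration (IsPartition n)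
partitions n = enumerate (≡-dec _≟_) (isPartition? n) (compositions n)
  λ {xs} (isPartition pos _ eq) → subst (λ m → xs ∈ compositions m) eq (compositions-complete pos)

recedingStacks : ∀ n → Enumeration (IsRecedingStack n)
recedingStacks n =
  enumerate (Product.≡-dec (≡-dec _≟_) (Product.≡-dec _≟_ (≡-dec _≟_)))
    (isRecedingStack? n) (concatMap markings (compositions n))
    λ {s} st → ∈-concatMap⁺ markings
      (lose (subst (λ m → entries s ∈ compositions m) (IsRecedingStack.size st)
                   (compositions-complete (stack⇒positive st)))
            (markings-complete (proj₁ s)))

p : ℕ → ℕ
p n = card (partitions n)

-- The empty stack has no summit, so size 0 is a convention.
gs : ℕ → ℕ
gs zero    = 1
gs (suc n) = card (recedingStacks (suc n))

p-0 : p 0 ≡ 1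
p-0 = refl

p-4 : p 4 ≡ 5
p-4 = refl

gs-4 : gs 4 ≡ 5
gs-4 = refl

{-# OPTIONS --safe #-}

-- Durfee's identity: a receding stack with summit c is its summit together with
-- the compulsory parts 1, …, c − 1 on either side and two arbitrary lists of parts
-- of size at most c; together the summit and the compulsory parts have sum c².
-- A partition with Durfee square c × c is that square, a partition into parts of
-- size at most c below it, and the conjugate of such a partition to its right.
-- Hence both objects are coded by c ≥ 1 and two vectors of c multiplicities.

module Submission where

open import Defs
open import Data.List using (List; []; _∷_; [_]; _++_; _ʳ++_; length; map; reverse)
open import Data.List.Membership.Propositional using (_∈_)
open import Data.List.Membership.Propositional.Properties using (∈-map⁺; ∈-map⁻)
open import Data.List.Membership.Propositional.Properties.WithK using (unique∧set⇒bag)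
open import Data.List.Properties
  using (∷-injective; ∷-injectiveʳ; length-map; length-reverse; reverse-++; reverse-injective;
         reverse-involutive; unfold-reverse; ʳ++-defn)
open import Data.List.Relation.Binary.BagAndSetEquality using (∼bag⇒↭)
open import Data.List.Relation.Binary.Permutation.Propositional using (↭-sym)
open import Data.List.Relation.Binary.Permutation.Propositional.Properties
  using (All-resp-↭; ↭-length; ↭-reverse; ++↭ʳ++)
open import Data.List.Relation.Unary.All as All using (All; []; _∷_)
open import Data.List.Relation.Unary.All.Properties using (++⁺)
open import Data.List.Relation.Unary.Any using (here; there)
open import Data.List.Relation.Unary.Any.Properties using (reverse⁺)
open import Data.List.Relation.Unary.Linked as Linked using (Linked; []; [-]; _∷_)
open import Data.List.Relation.Unary.Unique.Propositional using (Unique)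
import Data.List.Relation.Unary.Unique.Propositional.Properties as Unique
open import Data.Nat using (ℕ; zero; suc; _+_; _*_; _≤_; _≥_; _<_; z≤n; s≤s; s≤s⁻¹; _≤?_; _≤′_; ≤′-refl; ≤′-step)
open import Data.Nat.ListAction using (sum)
open import Data.Nat.ListAction.Properties using (sum-++; sum-↭)
open import Data.Nat.Properties
open import Data.Nat.Tactic.RingSolver using (solve-∀)
open import Data.Product using (∃; _×_; _,_; proj₁; proj₂)
open import Data.Sum using (_⊎_; inj₁; inj₂)
open import Data.Vec as Vec using (Vec; []; _∷_)
open import Function using (flip; _∘_)
open import Function.Bundles using (Equivalence; mk⇔)
open import Function.Definitions using (Injective)
open import Level using (0ℓ)
open import Relation.Binary.Core using (Rel)
open import Relation.Binary.PropositionalEquality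
  using (_≡_; refl; sym; trans; cong; cong₂; subst; subst₂; module ≡-Reasoning)
open import Relation.Nullary using (yes; no; contradiction)
open import Relation.Unary using (Pred)

private
  variable
    A B C : Set
    k : ℕ

-- Counting through a common set of codes.

preimages : {P : Pred A 0ℓ} (f : C → A) → (∀ {x} → P x → ∃ λ c → f c ≡ x) →
            ∀ {xs} → All P xs → ∃ λ cs → map f cs ≡ xs
preimages f f-surj []         = [] , refl
preimages f f-surj (px ∷ pxs) with f-surj px | preimages f f-surj pxs
... | c , refl | cs , refl = c ∷ cs , refl

-- The codes of the elements of `E`, mapped by `g`, form a duplicate-free list with the same members
-- as `F`, hence a permutation of it. `C` may hold codes of objects of every size, so `P` and `Q`
-- are compared code by code.
card-≡ : {P : Pred A 0ℓ} {Q : Pred B 0ℓ} (E : Enumeration P) (F : Enumeration Q)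
         (f : C → A) (g : C → B) → Injective _≡_ _≡_ f → Injective _≡_ _≡_ g →
         (∀ {x} → P x → ∃ λ c → f c ≡ x) → (∀ {y} → Q y → ∃ λ c → g c ≡ y) →
         (∀ c → P (f c) → Q (g c)) → (∀ c → Q (g c) → P (f c)) →
         card E ≡ card F
card-≡ {C = C} {P = P} {Q} E F f g f-inj g-inj f-surj g-surj P⇒Q Q⇒P = begin
  length E.elements   ≡⟨ cong length cs↦E ⟨
  length (map f cs)   ≡⟨ length-map f cs ⟩
  length cs           ≡⟨ length-map g cs ⟨
  length (map g cs)   ≡⟨ ↭-length (∼bag⇒↭ (unique∧set⇒bag g-unique F.unique (mk⇔ to from))) ⟩
  length F.elements   ∎
  where
  open ≡-Reasoning
  module E = Enumeration E
  module F = Enumeration F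

  codes : ∃ λ cs → map f cs ≡ E.elements
  codes = preimages f f-surj (All.tabulate (Equivalence.to E.exact))

  cs : List C
  cs = proj₁ codes

  cs↦E : map f cs ≡ E.elements
  cs↦E = proj₂ codes

  g-unique = Unique.map⁺ g-inj (Unique.map⁻ (subst Unique (sym cs↦E) E.unique))

  to : ∀ {y} → y ∈ map g cs → y ∈ F.elements
  to y∈ with ∈-map⁻ g y∈
  ... | c , c∈ , refl = Equivalence.from F.exact (P⇒Q c
          (Equivalence.to E.exact (subst (f c ∈_) cs↦E (∈-map⁺ f c∈))))

  from : ∀ {y} → y ∈ F.elements → y ∈ map g cs
  from y∈ with g-surj (Equivalence.to F.exact y∈)
  ... | c , refl with ∈-map⁻ f (subst (f c ∈_) (sym cs↦E)
                       (Equivalence.from E.exact (Q⇒P c (Equivalence.to F.exact y∈))))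
  -- The code found in `cs` is only known to have the same image under `f` as `c`.
  ... | c′ , c′∈ , eq = ∈-map⁺ g (subst (_∈ cs) (sym (f-inj eq)) c′∈)

-- Splitting, reversing and summing lists.

++-injective : ∀ (xs xs′ : List A) {ys ys′} → length xs ≡ length xs′ →
               xs ++ ys ≡ xs′ ++ ys′ → xs ≡ xs′ × ys ≡ ys′
++-injective []       []         _   eq = refl , eq
++-injective (x ∷ xs) (x′ ∷ xs′) len eq with ∷-injective eq
... | refl , eq′ with ++-injective xs xs′ (suc-injective len) eq′
... | refl , eq″ = refl , eq″

linked-reverse : {R : Rel A 0ℓ} {xs : List A} → Linked R xs → Linked (flip R) (reverse xs)
linked-reverse {R = R} {[]}     []  = []
linked-reverse {R = R} {x ∷ xs} lnk = go xs lnk [-]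
  where
  go : ∀ {x} xs {acc} → Linked R (x ∷ xs) → Linked (flip R) (x ∷ acc) →
       Linked (flip R) (xs ʳ++ (x ∷ acc))
  go []       _           acc = acc
  go (_ ∷ xs) (r ∷ rs)    acc = go xs rs (r ∷ acc)

-- This turns the chain from 1 up to the summit into a chain from the summit down to 1, so that the
-- left side of a stack can be treated as a right side.
reverse-bracketed : ∀ (a b : A) xs → reverse (a ∷ xs ++ [ b ]) ≡ b ∷ reverse xs ++ [ a ]
reverse-bracketed a b xs =
  trans (unfold-reverse a (xs ++ [ b ])) (cong (_++ [ a ]) (reverse-++ xs [ b ]))

linked-++⁻ˡ : {R : Rel A 0ℓ} (xs : List A) {ys : List A} → Linked R (xs ++ ys) → Linked R xs
linked-++⁻ˡ []           _         = []
linked-++⁻ˡ (_ ∷ [])     _         = [-]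
linked-++⁻ˡ (_ ∷ y ∷ xs) (r ∷ lnk) = r ∷ linked-++⁻ˡ (y ∷ xs) lnk

sum-reverse : ∀ xs → sum (reverse xs) ≡ sum xs
sum-reverse xs = sum-↭ (↭-reverse xs)

sum-ʳ++ : ∀ xs ys → sum (xs ʳ++ ys) ≡ sum xs + sum ys
sum-ʳ++ xs ys = trans (sym (sum-↭ (++↭ʳ++ xs ys))) (sum-++ xs ys)

-- Partitions with bounded parts as vectors of multiplicities.

-- The head of a vector of length k is the multiplicity of the part k.
parts : Vec ℕ k → List ℕ
parts []                   = []
parts (zero ∷ ms)          = parts ms
parts {suc k} (suc m ∷ ms) = suc k ∷ parts (m ∷ ms)

parts-≤ : (ms : Vec ℕ k) → All (_≤ k) (parts ms)
parts-≤ []           = []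
parts-≤ (zero ∷ ms)  = All.map m≤n⇒m≤1+n (parts-≤ ms)
parts-≤ (suc m ∷ ms) = ≤-refl ∷ parts-≤ (m ∷ ms)

parts-positive : (ms : Vec ℕ k) → All (1 ≤_) (parts ms)
parts-positive []           = []
parts-positive (zero ∷ ms)  = parts-positive ms
parts-positive (suc m ∷ ms) = s≤s z≤n ∷ parts-positive (m ∷ ms)

-- The bound `c` is kept apart from `k` because a multiplicity zero lowers `k` while the preceding
-- entry of the chain stays the same.
parts-falling : ∀ {c} → 1 ≤ c → k ≤ c → (ms : Vec ℕ k) → Linked _≥_ (c ∷ parts ms ++ [ 1 ])
parts-falling 1≤c k≤c []           = 1≤c ∷ [-]
parts-falling 1≤c k<c (zero ∷ ms)  = parts-falling 1≤c (<⇒≤ k<c) ms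
parts-falling 1≤c k<c (suc m ∷ ms) = k<c ∷ parts-falling (s≤s z≤n) ≤-refl (m ∷ ms)

parts-injective : (ms ns : Vec ℕ k) → parts ms ≡ parts ns → ms ≡ ns
parts-injective []           []           _  = refl
parts-injective (zero ∷ ms)  (zero ∷ ns)  eq = cong (zero ∷_) (parts-injective ms ns eq)
parts-injective (suc m ∷ ms) (suc n ∷ ns) eq
  with refl ← parts-injective (m ∷ ms) (n ∷ ns) (∷-injectiveʳ eq) = refl
parts-injective (zero ∷ ms)  (suc n ∷ ns) eq =
  -- One list begins with `suc k`, while multiplicity zero bounds the other by `k`.
  contradiction (All.head (subst (All (_≤ _)) eq (parts-≤ ms))) (n≮n _)
parts-injective (suc m ∷ ms) (zero ∷ ns)  eq =
  contradiction (All.head (subst (All (_≤ _)) (sym eq) (parts-≤ ns))) (n≮n _)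

parts-pad : ∀ {j} → j ≤′ k → (ms : Vec ℕ j) → ∃ λ (ns : Vec ℕ k) → parts ns ≡ parts ms
parts-pad ≤′-refl       ms = ms , refl
parts-pad (≤′-step j≤k) ms = let ns , eq = parts-pad j≤k ms in zero ∷ ns , eq

parts-surjective : ∀ k xs → All (1 ≤_) xs → Linked _≥_ (k ∷ xs) → ∃ λ (ms : Vec ℕ k) → parts ms ≡ xs
parts-surjective k []           _         _           = parts-pad z≤′n []
parts-surjective k (suc x ∷ xs) (_ ∷ pos) (x<k ∷ lnk) with parts-surjective (suc x) xs pos lnk
-- The recursion takes the head `suc x` as its bound, so `m` counts the further copies of it.
-- Padding gives the values above `suc x` multiplicity zero.
... | m ∷ ms , refl = parts-pad (≤⇒≤′ x<k) (suc m ∷ ms)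

sum-parts : ∀ m (ms : Vec ℕ k) → sum (parts (m ∷ ms)) ≡ suc k * m + sum (parts ms)
sum-parts {k} zero    ms = cong (_+ sum (parts ms)) (sym (*-zeroʳ k))
sum-parts {k} (suc m) ms = trans (cong (suc k +_) (sum-parts m ms)) (arith k m (sum (parts ms)))
  where
  arith : ∀ k m s → suc k + (suc k * m + s) ≡ suc k * suc m + s
  arith = solve-∀

parts-drop : ∀ {i} m (ms : Vec ℕ k) → i ≤ k → i ∈ parts (m ∷ ms) → i ∈ parts ms
parts-drop zero    ms i≤k i∈           = i∈
parts-drop (suc m) ms i≤k (here refl)  = contradiction i≤k (n≮n _)
parts-drop (suc m) ms i≤k (there i∈)   = parts-drop m ms i≤k i∈

parts-keep : ∀ {i} m (ms : Vec ℕ k) → i ∈ parts ms → i ∈ parts (m ∷ ms)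
parts-keep zero    ms i∈ = i∈
parts-keep (suc m) ms i∈ = there (parts-keep m ms i∈)

parts-sucs : ∀ {i} (ms : Vec ℕ k) → 1 ≤ i → i ≤ k → i ∈ parts (Vec.map suc ms)
parts-sucs []       1≤i i≤0 = contradiction (≤-trans 1≤i i≤0) (n≮n 0)
parts-sucs (m ∷ ms) 1≤i i≤  with m≤n⇒m<n∨m≡n i≤
... | inj₁ i<1+k = parts-keep (suc m) (Vec.map suc ms) (parts-sucs ms 1≤i (s≤s⁻¹ i<1+k))
... | inj₂ refl  = here refl

all-parts⇒sucs : (ms : Vec ℕ k) → (∀ i → 1 ≤ i → i ≤ k → i ∈ parts ms) →
                 ∃ λ (us : Vec ℕ k) → Vec.map suc us ≡ ms
all-parts⇒sucs []           _   = [] , refl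
all-parts⇒sucs {suc k} (zero ∷ ms) all =
  contradiction (All.lookup (parts-≤ ms) (all (suc k) (s≤s z≤n) ≤-refl)) (n≮n k)
all-parts⇒sucs (suc m ∷ ms) all
  with all-parts⇒sucs ms (λ i 1≤i i≤k → parts-drop (suc m) ms i≤k (all i 1≤i (m≤n⇒m≤1+n i≤k)))
... | us , refl = m ∷ us , refl

map-suc-injective : (us vs : Vec ℕ k) → Vec.map suc us ≡ Vec.map suc vs → us ≡ vs
map-suc-injective []       []       _    = refl
map-suc-injective (u ∷ us) (v ∷ vs) eq =
  cong₂ _∷_ (suc-injective (cong Vec.head eq)) (map-suc-injective us vs (cong Vec.tail eq))

-- The two sides of a receding stack.

-- Smaller values than the summit suc k must occur, hence the suc, but suc k itself need not.
sideParts : Vec ℕ (suc k) → List ℕ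
sideParts (u ∷ us) = parts (u ∷ Vec.map suc us)

sideParts-injective : (us vs : Vec ℕ (suc k)) → sideParts us ≡ sideParts vs → us ≡ vs
sideParts-injective (u ∷ us) (v ∷ vs) eq =
  let eq′ = parts-injective (u ∷ Vec.map suc us) (v ∷ Vec.map suc vs) eq
  in cong₂ _∷_ (cong Vec.head eq′) (map-suc-injective us vs (cong Vec.tail eq′))

sideParts-falling : (us : Vec ℕ (suc k)) → Linked _≥_ (suc k ∷ sideParts us ++ [ 1 ])
sideParts-falling (u ∷ us) = parts-falling (s≤s z≤n) ≤-refl (u ∷ Vec.map suc us)

sideParts-receding : ∀ {i} (us : Vec ℕ (suc k)) → 1 ≤ i → i < suc k → i ∈ sideParts us
sideParts-receding (u ∷ us) 1≤i i<1+k = parts-keep u (Vec.map suc us) (parts-sucs us 1≤i (s≤s⁻¹ i<1+k))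

sideParts-surjective : ∀ xs → Linked _≥_ (suc k ∷ xs ++ [ 1 ]) →
                       (∀ i → 1 ≤ i → i < suc k → i ∈ xs) →
                       ∃ λ (us : Vec ℕ (suc k)) → sideParts us ≡ xs
sideParts-surjective {k} xs falling receding
  with parts-surjective (suc k) xs (All.tail (falling⇒positive xs falling))
         (linked-++⁻ˡ (suc k ∷ xs) falling)
... | m ∷ ms , refl
  with all-parts⇒sucs ms (λ i 1≤i i≤k → parts-drop m ms i≤k (receding i 1≤i (s≤s i≤k)))
... | us , refl = m ∷ us , refl

-- The triangular number: the sum of the compulsory parts on one side of the summit `suc k`.
triangle : ℕ → ℕ
triangle zero    = 0
triangle (suc k) = suc k + triangle k

sum-sucs : (us : Vec ℕ k) → sum (parts (Vec.map suc us)) ≡ triangle k + sum (parts us)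
sum-sucs         []       = refl
sum-sucs {suc k} (u ∷ us) = begin
  suc k + sum (parts (u ∷ Vec.map suc us))             ≡⟨ cong (suc k +_) (sum-parts u _) ⟩
  suc k + (suc k * u + sum (parts (Vec.map suc us)))   ≡⟨ cong (λ s → suc k + (suc k * u + s)) (sum-sucs us) ⟩
  suc k + (suc k * u + (triangle k + sum (parts us)))  ≡⟨ arith (suc k) (suc k * u) (triangle k) _ ⟩
  suc k + triangle k + (suc k * u + sum (parts us))    ≡⟨ cong (suc k + triangle k +_) (sum-parts u us) ⟨
  suc k + triangle k + sum (parts (u ∷ us))            ∎
  where
  open ≡-Reasoning
  arith : ∀ a b c d → a + (b + (c + d)) ≡ a + c + (b + d)
  arith = solve-∀

sum-sideParts : (us : Vec ℕ (suc k)) → sum (sideParts us) ≡ triangle k + sum (parts us)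
sum-sideParts {k} (u ∷ us) = begin
  sum (parts (u ∷ Vec.map suc us))             ≡⟨ sum-parts u _ ⟩
  suc k * u + sum (parts (Vec.map suc us))     ≡⟨ cong (suc k * u +_) (sum-sucs us) ⟩
  suc k * u + (triangle k + sum (parts us))    ≡⟨ arith (suc k * u) (triangle k) _ ⟩
  triangle k + (suc k * u + sum (parts us))    ≡⟨ cong (triangle k +_) (sum-parts u us) ⟨
  triangle k + sum (parts (u ∷ us))            ∎
  where
  open ≡-Reasoning
  arith : ∀ a b c → a + (b + c) ≡ b + (a + c)
  arith = solve-∀

-- Induction by gnomons: the square of side `suc (suc k)` exceeds that of side `suc k` by
-- `3 + 2 * k`.
square≡triangles : ∀ k → triangle k + suc k + triangle k ≡ suc k * suc k
square≡triangles zero    = refl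
square≡triangles (suc k) = begin
  suc k + triangle k + suc (suc k) + (suc k + triangle k)  ≡⟨ arith k (triangle k) ⟩
  triangle k + suc k + triangle k + (3 + 2 * k)            ≡⟨ cong (_+ (3 + 2 * k)) (square≡triangles k) ⟩
  suc k * suc k + (3 + 2 * k)                              ≡⟨ arith′ k ⟩
  suc (suc k) * suc (suc k)                                ∎
  where
  open ≡-Reasoning
  arith : ∀ k t → suc k + t + suc (suc k) + (suc k + t) ≡ t + suc k + t + (3 + 2 * k)
  arith = solve-∀
  arith′ : ∀ k → suc k * suc k + (3 + 2 * k) ≡ suc (suc k) * suc (suc k)
  arith′ = solve-∀

-- Rows through the Durfee square.

-- Smallest row first: u at the head of a vector of length k lengthens k rows by u,
-- and conjugation turns this into u parts equal to k.
rows : ℕ → Vec ℕ k → List ℕ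
rows b []       = []
rows b (u ∷ us) = b + u ∷ rows (b + u) us

length-rows : ∀ b (us : Vec ℕ k) → length (rows b us) ≡ k
length-rows b []       = refl
length-rows b (u ∷ us) = cong suc (length-rows (b + u) us)

rows-≥ : ∀ b (us : Vec ℕ k) → All (b ≤_) (rows b us)
rows-≥ b []       = []
rows-≥ b (u ∷ us) = m≤m+n b u ∷ All.map (≤-trans (m≤m+n b u)) (rows-≥ (b + u) us)

rows-injective : ∀ b (us vs : Vec ℕ k) → rows b us ≡ rows b vs → us ≡ vs
rows-injective b []       []       _  = refl
rows-injective b (u ∷ us) (v ∷ vs) eq with ∷-injective eq
... | b+u≡b+v , eq′ with refl ← +-cancelˡ-≡ b u v b+u≡b+v =
  cong (u ∷_) (rows-injective (b + u) us vs eq′)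

-- The entries of the vector are the successive differences of the rising list.
rows-surjective : ∀ b xs → Linked _≤_ (b ∷ xs) → ∃ λ (us : Vec ℕ (length xs)) → rows b us ≡ xs
rows-surjective b []       _           = [] , refl
rows-surjective b (x ∷ xs) (b≤x ∷ lnk) with m≤n⇒∃[o]m+o≡n b≤x
... | u , refl = let us , eq = rows-surjective (b + u) xs lnk in u ∷ us , cong (b + u ∷_) eq

rows-decreasing : ∀ b (us : Vec ℕ k) {ys} → Linked _≥_ (b ∷ ys) → Linked _≥_ (rows b us ʳ++ ys)
rows-decreasing b []       lnk = Linked.tail lnk
-- The new row `b + u` appears twice: as the head of the accumulated list and as the lower bound for
-- the rows still to come.
rows-decreasing b (u ∷ us) lnk = rows-decreasing (b + u) us (≤-refl ∷ raise lnk)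
  where
  raise : ∀ {ys} → Linked _≥_ (b ∷ ys) → Linked _≥_ (b + u ∷ ys)
  raise [-]         = [-]
  raise (y≤b ∷ lnk) = ≤-trans y≤b (m≤m+n b u) ∷ lnk

-- The size-preserving half of conjugation: `k * b` is the rectangle common to all rows, and an
-- entry `u` with `k` rows still to fill adds `k * u`, as do `u` parts equal to `k`.
sum-rows : ∀ b (us : Vec ℕ k) → sum (rows b us) ≡ k * b + sum (parts us)
sum-rows         b []       = refl
sum-rows {suc k} b (u ∷ us) = begin
  b + u + sum (rows (b + u) us)                ≡⟨ cong (b + u +_) (sum-rows (b + u) us) ⟩
  b + u + (k * (b + u) + sum (parts us))       ≡⟨ arith k b u _ ⟩
  suc k * b + (suc k * u + sum (parts us))     ≡⟨ cong (suc k * b +_) (sum-parts u us) ⟨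
  suc k * b + sum (parts (u ∷ us))             ∎
  where
  open ≡-Reasoning
  arith : ∀ k b u s → b + u + (k * (b + u) + s) ≡ suc k * b + (suc k * u + s)
  arith = solve-∀

-- Receding stacks from codes.

-- In (k , us , vs), suc k is the summit, or the side of the Durfee square.
Code : Set
Code = ∃ λ k → Vec ℕ (suc k) × Vec ℕ (suc k)

weight : Code → ℕ
weight (k , us , vs) = suc k * suc k + (sum (parts us) + sum (parts vs))

stack : Code → MarkedSequence
stack (k , us , vs) = reverse (sideParts us) , suc k , sideParts vs

stack-injective : Injective _≡_ _≡_ stack
stack-injective {k , us , vs} {k′ , us′ , vs′} eq
  with refl ← cong (proj₁ ∘ proj₂) eq
  with refl ← sideParts-injective us us′ (reverse-injective (cong proj₁ eq))
  with refl ← sideParts-injective vs vs′ (cong (proj₂ ∘ proj₂) eq) = refl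

sum-stack : ∀ c → sum (entries (stack c)) ≡ weight c
sum-stack (k , us , vs) = begin
  sum (reverse (sideParts us) ++ suc k ∷ sideParts vs)
    ≡⟨ sum-++ (reverse (sideParts us)) _ ⟩
  sum (reverse (sideParts us)) + (suc k + sum (sideParts vs))
    ≡⟨ cong (_+ _) (sum-reverse (sideParts us)) ⟩
  sum (sideParts us) + (suc k + sum (sideParts vs))
    ≡⟨ cong₂ (λ s t → s + (suc k + t)) (sum-sideParts us) (sum-sideParts vs) ⟩
  triangle k + sum (parts us) + (suc k + (triangle k + sum (parts vs)))
    ≡⟨ arith (triangle k) (sum (parts us)) (suc k) (sum (parts vs)) ⟩
  triangle k + suc k + triangle k + (sum (parts us) + sum (parts vs))
    ≡⟨ cong (_+ (sum (parts us) + sum (parts vs))) (square≡triangles k) ⟩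
  suc k * suc k + (sum (parts us) + sum (parts vs)) ∎
  where
  open ≡-Reasoning
  arith : ∀ t a c b → t + a + (c + (t + b)) ≡ t + c + t + (a + b)
  arith = solve-∀

stack-isRecedingStack : ∀ c → IsRecedingStack (weight c) (stack c)
stack-isRecedingStack c@(k , us , vs) = isRecedingStack
  (subst (Linked _≤_) (reverse-bracketed (suc k) 1 (sideParts us)) (linked-reverse (sideParts-falling us)))
  (sideParts-falling vs)
  (λ i 1≤i i<c → reverse⁺ (sideParts-receding us 1≤i i<c) , sideParts-receding vs 1≤i i<c)
  (sum-stack c)

stack-surjective : ∀ {n s} → IsRecedingStack n s → ∃ λ c → stack c ≡ s
stack-surjective {s = l , zero , r} (isRecedingStack _ falling _ _) =
  contradiction (All.head (falling⇒positive r falling)) (n≮n 0)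
stack-surjective {s = l , suc k , r} (isRecedingStack rising falling receding _)
  with sideParts-surjective (reverse l)
         (subst (Linked _≥_) (reverse-bracketed 1 (suc k) l) (linked-reverse rising))
         (λ i 1≤i i<c → reverse⁺ (proj₁ (receding i 1≤i i<c)))
     | sideParts-surjective r falling (λ i 1≤i i<c → proj₂ (receding i 1≤i i<c))
... | us , eq | vs , refl =
  (k , us , vs) , cong (_, suc k , sideParts vs) (trans (cong reverse eq) (reverse-involutive l))

-- Partitions from codes, and uniqueness and existence of the Durfee square.

partition : Code → List ℕ
partition (k , us , vs) = rows (suc k) us ʳ++ parts vs

-- If `xs` outlasts `xs′`, the first entry of `xs` beyond `xs′` is also the first entry of `ys′`, so
-- it lies between `a` and `b`.
long-or-bounded : ∀ {a b} (xs xs′ : List ℕ) {ys ys′} → All (a ≤_) xs → All (_≤ b) ys′ →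
          xs ++ ys ≡ xs′ ++ ys′ → length xs ≤ length xs′ ⊎ a ≤ b
long-or-bounded []       xs′       _           _   _  = inj₁ z≤n
long-or-bounded (x ∷ xs) []        (a≤x ∷ _)   ≤b  eq = inj₂ (≤-trans a≤x (All.head (subst (All _) (sym eq) ≤b)))
long-or-bounded (x ∷ xs) (x′ ∷ xs′) (_ ∷ a≤xs) ≤b  eq with long-or-bounded xs xs′ a≤xs ≤b (∷-injectiveʳ eq)
... | inj₁ len = inj₁ (s≤s len)
... | inj₂ a≤b = inj₂ a≤b

-- A larger square in `c` would make the first row below the square of `c′` at least `suc k`, yet
-- that row is at most `suc k′`. Used in both directions, this shows that a partition determines the
-- side of its square.
partition-≡⇒≤ : ∀ c c′ → partition c ≡ partition c′ → proj₁ c ≤ proj₁ c′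
partition-≡⇒≤ (k , us , vs) (k′ , us′ , vs′) eq
  with long-or-bounded (reverse (rows (suc k) us)) (reverse (rows (suc k′) us′))
         (All-resp-↭ (↭-sym (↭-reverse (rows (suc k) us))) (rows-≥ (suc k) us)) (parts-≤ vs′)
         (trans (sym (ʳ++-defn (rows (suc k) us))) (trans eq (ʳ++-defn (rows (suc k′) us′))))
... | inj₂ k≤k′ = s≤s⁻¹ k≤k′
... | inj₁ len  = s≤s⁻¹ (subst₂ _≤_ (length-reverse-rows us) (length-reverse-rows us′) len)
  where
  length-reverse-rows : ∀ {k b} (us : Vec ℕ k) → length (reverse (rows b us)) ≡ k
  length-reverse-rows us = trans (length-reverse (rows _ us)) (length-rows _ us)

partition-injective : Injective _≡_ _≡_ partition
partition-injective {c@(k , us , vs)} {c′@(k′ , us′ , vs′)} eq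
  with refl ← ≤-antisym (partition-≡⇒≤ c c′ eq) (partition-≡⇒≤ c′ c (sym eq))
  with top , bottom ← ++-injective (reverse (rows (suc k) us)) (reverse (rows (suc k) us′))
         (trans (length-reverse (rows (suc k) us)) (trans (length-rows (suc k) us)
           (sym (trans (length-reverse (rows (suc k) us′)) (length-rows (suc k) us′)))))
         (trans (sym (ʳ++-defn (rows (suc k) us))) (trans eq (ʳ++-defn (rows (suc k) us′))))
  with refl ← rows-injective (suc k) us us′ (reverse-injective top)
  with refl ← parts-injective vs vs′ bottom = refl

sum-partition : ∀ c → sum (partition c) ≡ weight c
sum-partition (k , us , vs) = begin
  sum (rows (suc k) us ʳ++ parts vs)                    ≡⟨ sum-ʳ++ (rows (suc k) us) (parts vs) ⟩
  sum (rows (suc k) us) + sum (parts vs)                ≡⟨ cong (_+ _) (sum-rows (suc k) us) ⟩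
  suc k * suc k + sum (parts us) + sum (parts vs)       ≡⟨ +-assoc (suc k * suc k) _ _ ⟩
  suc k * suc k + (sum (parts us) + sum (parts vs))     ∎
  where open ≡-Reasoning

partition-isPartition : ∀ c → IsPartition (weight c) (partition c)
partition-isPartition c@(k , us , vs) = isPartition
  (All-resp-↭ (++↭ʳ++ (rows (suc k) us) (parts vs))
    (++⁺ (All.map (≤-trans (s≤s z≤n)) (rows-≥ (suc k) us)) (parts-positive vs)))
  (rows-decreasing (suc k) us
    (linked-++⁻ˡ (suc k ∷ parts vs) (parts-falling (s≤s z≤n) ≤-refl vs)))
  (sum-partition c)

-- The side is the number of rows in `a ∷ top`: these rows are at least that long and the remaining
-- ones at most that long, as for a Durfee square.
cut : ∀ a top rest → Linked _≤_ (suc (length top) ∷ a ∷ top) → Linked _≥_ (suc (length top) ∷ rest) →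
      All (1 ≤_) rest → ∃ λ c → partition c ≡ top ʳ++ (a ∷ rest)
cut a top rest rising falling pos
  with rows-surjective (suc (length top)) (a ∷ top) rising
     | parts-surjective (suc (length top)) rest pos falling
... | us , eq | vs , refl = (length top , us , vs) , cong (_ʳ++ parts vs) eq

-- Rows are moved to the top, whose smallest row is a, as long as they are longer than
-- the number of rows already there.
durfee : ∀ a top rest → Linked _≤_ (a ∷ top) → Linked _≥_ (a ∷ rest) → length top < a →
         All (1 ≤_) rest → ∃ λ c → partition c ≡ top ʳ++ (a ∷ rest)
durfee a top []       rising falling top<a pos = cut a top [] (top<a ∷ rising) [-] pos
durfee a top (x ∷ xs) rising (x≤a ∷ falling) top<a pos with x ≤? suc (length top)
... | yes x≤ = cut a top (x ∷ xs) (top<a ∷ rising) (x≤ ∷ falling) pos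
... | no  x≰ = durfee x (a ∷ top) xs (x≤a ∷ rising) falling (≰⇒> x≰) (All.tail pos)

partition-surjective : ∀ {n xs} → IsPartition (suc n) xs → ∃ λ c → partition c ≡ xs
-- Every code has a square of side at least 1, so the empty partition has no code; the positive size
-- excludes it.
partition-surjective {xs = []}     (isPartition _ _ ())
partition-surjective {xs = x ∷ xs} (isPartition (1≤x ∷ pos) lnk _) = durfee x [] xs [-] lnk 1≤x pos

proposition2p1 : (n : ℕ) → gs n ≡ p n
proposition2p1 zero    = refl
proposition2p1 (suc n) =
  card-≡ (recedingStacks (suc n)) (partitions (suc n)) stack partition
    stack-injective partition-injective stack-surjective partition-surjective
    -- The stack and the partition of `c` both have size `weight c`, so if one has size `suc n`, so
    -- does the other.
    (λ c st → subst (λ m → IsPartition m (partition c))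
      (trans (sym (sum-stack c)) (IsRecedingStack.size st)) (partition-isPartition c))
    (λ c pt → subst (λ m → IsRecedingStack m (stack c))
      (trans (sym (sum-partition c)) (IsPartition.size pt)) (stack-isRecedingStack c))
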